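{- Let $n\geq 1$ and let $\mathcal{N}:L_n([0,1])\to L_n([0,1])$ be an $n$-dimensional strong fuzzy negation. Then for each $\mathbf{x}\in L_n([0,1])$ with $\mathbf{x}\notin\mathcal{D}_n$, one has $\mathcal{N}(\mathbf{x})\notin\mathcal{D}_n$.
   Context: $L_n([0,1])=\{(x_1,\ldots,x_n)\in[0,1]^n : x_1\leq\cdots\leq x_n\}$ with the componentwise order. For $x\in[0,1]$, $/x/=(x,\ldots,x)$; $\mathcal{D}_n=\{/x/ : x\in[0,1]\}$ is the set of degenerate elements. An $n$-dimensional fuzzy negation is a function $\mathcal{N}:L_n([0,1])\to L_n([0,1])$ with $\mathcal{N}(/0/)=/1/$, $\mathcal{N}(/1/)=/0/$ and $\mathcal{N}(\mathbf{x})\geq\mathcal{N}(\mathbf{y})$ whenever $\mathbf{x}\leq\mathbf{y}$. It is strong if $\mathcal{N}(\mathcal{N}(\mathbf{x}))=\mathbf{x}$ for all $\mathbf{x}\in L_n([0,1])$. -}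

module Defs where

open import Data.Fin.Base as Fin using (Fin)
open import Data.Nat.Base using (ℕ)
open import Data.Product.Base using (_×_; _,_; ∃; proj₁; proj₂; swap)
open import Data.Rational.Base as ℚ using (ℚ; 0ℚ; 1ℚ)
import Data.Rational.Properties as ℚ
open import Data.Sum.Base using (_⊎_; inj₁; inj₂)
open import Data.Vec.Functional using (Vector)
open import Data.Vec.Functional.Relation.Binary.Pointwise using (Pointwise)
open import Function.Base using (id; _∘_)
open import Function.Bundles using (Func; _⟶ₛ_)
open import Level using (0ℓ) renaming (suc to lsuc)
open import Relation.Binary.Bundles using (Poset; Setoid)
open import Relation.Binary.PropositionalEquality using (subst)
open import Relation.Nullary.Decidable using (yes; no)
open import Relation.Nullary.Negation using (¬_)
open import Relation.Unary using (Pred)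

-- Two-sided Dedekind cuts of ℚ. Classically, locatedness says that at most
-- one rational lies in neither class.
record ℝ : Set₁ where
  field
    Lower           : Pred ℚ 0ℓ
    Upper           : Pred ℚ 0ℓ
    lower-inhabited : ∃ Lower
    upper-inhabited : ∃ Upper
    lower-closed    : ∀ {p q} → p ℚ.< q → Lower q → Lower p
    upper-closed    : ∀ {p q} → p ℚ.< q → Upper p → Upper q
    lower-open      : ∀ {p} → Lower p → ∃ λ q → p ℚ.< q × Lower q
    upper-open      : ∀ {q} → Upper q → ∃ λ p → p ℚ.< q × Upper p
    disjoint        : ∀ {q} → ¬ (Lower q × Upper q)
    located         : ∀ {p q} → p ℚ.< q → Lower p ⊎ Upper q

open ℝ public

infix 4 _≤ᴿ_ _≈ᴿ_

-- Inclusion of lower classes; by locatedness it implies the reverse inclusion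
-- of upper classes, so ≈ᴿ identifies cuts with the same two classes.
_≤ᴿ_ : ℝ → ℝ → Set
x ≤ᴿ y = ∀ q → Lower x q → Lower y q

_≈ᴿ_ : ℝ → ℝ → Set
x ≈ᴿ y = x ≤ᴿ y × y ≤ᴿ x

fromℚ : ℚ → ℝ
fromℚ r = record
  { Lower           = ℚ._< r
  ; Upper           = r ℚ.<_
  ; lower-inhabited = r ℚ.- 1ℚ ,
      subst (r ℚ.- 1ℚ ℚ.<_) (ℚ.+-identityʳ r)
        (ℚ.+-monoʳ-< r (ℚ.negative⁻¹ (ℚ.- 1ℚ)))
  ; upper-inhabited = r ℚ.+ 1ℚ ,
      subst (ℚ._< r ℚ.+ 1ℚ) (ℚ.+-identityʳ r)
        (ℚ.+-monoʳ-< r (ℚ.positive⁻¹ 1ℚ))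
  ; lower-closed    = ℚ.<-trans
  ; upper-closed    = λ p<q r<p → ℚ.<-trans r<p p<q
  ; lower-open      = λ p<r → let (m , p<m , m<r) = ℚ.<-dense p<r in m , p<m , m<r
  ; upper-open      = λ r<q → let (m , r<m , m<q) = ℚ.<-dense r<q in m , m<q , r<m
  ; disjoint        = λ (q<r , r<q) → ℚ.<-asym q<r r<q
  ; located         = loc
  }
  where
  loc : ∀ {p q} → p ℚ.< q → p ℚ.< r ⊎ r ℚ.< q
  loc {p} p<q with p ℚ.<? r
  ... | yes p<r = inj₁ p<r
  ... | no  p≮r = inj₂ (ℚ.≤-<-trans (ℚ.≮⇒≥ p≮r) p<q)

0ᴿ 1ᴿ : ℝ
0ᴿ = fromℚ 0ℚ
1ᴿ = fromℚ 1ℚ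

record [0,1] : Set₁ where
  constructor mk[0,1]
  field
    value : ℝ
    0≤    : 0ᴿ ≤ᴿ value
    ≤1    : value ≤ᴿ 1ᴿ

open [0,1] public

infix 4 _≤ᴵ_ _≈ᴵ_

_≤ᴵ_ : [0,1] → [0,1] → Set
a ≤ᴵ b = value a ≤ᴿ value b

_≈ᴵ_ : [0,1] → [0,1] → Set
a ≈ᴵ b = value a ≈ᴿ value b

0≤ᴿ1 : 0ᴿ ≤ᴿ 1ᴿ
0≤ᴿ1 q q<0 = ℚ.<-trans q<0 (ℚ.positive⁻¹ 1ℚ)

0ᴵ 1ᴵ : [0,1]
0ᴵ = mk[0,1] 0ᴿ (λ _ → id) 0≤ᴿ1
1ᴵ = mk[0,1] 1ᴿ 0≤ᴿ1 (λ _ → id)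

record L (n : ℕ) : Set₁ where
  constructor mkL
  field
    coord  : Vector [0,1] n
    sorted : ∀ {i j} → i Fin.≤ j → coord i ≤ᴵ coord j

open L public

infix 4 _≤ᴸ_ _≈ᴸ_

_≤ᴸ_ : ∀ {n} → L n → L n → Set
x ≤ᴸ y = Pointwise _≤ᴵ_ (coord x) (coord y)

_≈ᴸ_ : ∀ {n} → L n → L n → Set
x ≈ᴸ y = Pointwise _≈ᴵ_ (coord x) (coord y)

L-poset : ℕ → Poset (lsuc 0ℓ) 0ℓ 0ℓ
L-poset n = record
  { Carrier        = L n
  ; _≈_            = _≈ᴸ_
  ; _≤_            = _≤ᴸ_
  ; isPartialOrder = record
    { isPreorder = record
      { isEquivalence = record
        { refl  = λ i → (λ _ → id) , (λ _ → id)
        ; sym   = λ x≈y i → swap (x≈y i)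
        ; trans = λ x≈y y≈z i →
            (λ q → proj₁ (y≈z i) q ∘ proj₁ (x≈y i) q) ,
            (λ q → proj₂ (x≈y i) q ∘ proj₂ (y≈z i) q)
        }
      ; reflexive = λ x≈y i → proj₁ (x≈y i)
      ; trans     = λ x≤y y≤z i q → y≤z i q ∘ x≤y i q
      }
    ; antisym = λ x≤y y≤x i → x≤y i , y≤x i
    }
  }

L-setoid : ℕ → Setoid (lsuc 0ℓ) 0ℓ
L-setoid n = Poset.Eq.setoid (L-poset n)

/_/ : ∀ {n} → [0,1] → L n
/ a / = mkL (λ _ → a) (λ _ _ → id)

𝓓 : ∀ n → Pred (L n) (lsuc 0ℓ)
𝓓 n x = ∃ λ a → x ≈ᴸ / a /

record IsFuzzyNegation {n : ℕ} (N : L-setoid n ⟶ₛ L-setoid n) : Set₁ where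
  open Func N using (to)
  field
    to-0     : to / 0ᴵ / ≈ᴸ / 1ᴵ /
    to-1     : to / 1ᴵ / ≈ᴸ / 0ᴵ /
    antitone : ∀ {x y} → x ≤ᴸ y → to y ≤ᴸ to x

record IsStrongFuzzyNegation {n : ℕ} (N : L-setoid n ⟶ₛ L-setoid n) : Set₁ where
  open Func N using (to)
  field
    isFuzzyNegation : IsFuzzyNegation N
    involutive      : ∀ x → to (to x) ≈ᴸ x

{-# OPTIONS --safe #-}

-- Write x = 𝒩(/a/). Since 𝒩 is an order anti-automorphism and /a/ is both
-- meet- and join-irreducible, so is x. Irreducibility of x forces each
-- coordinate of x to equal 0 or the last coordinate, and forces x to be degenerate
-- or to have last coordinate 1. The latter happens only for a = 0: otherwise
-- for 0 < b < a also 𝒩(/b/) has last coordinate 1 and its coordinates are 0 or 1,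
-- and as 𝒩(/b/) > x it has fewer zeros, so a descent on the number of zeros
-- applies. Since the goal is a negation, reals may be compared up to ¬¬.
module Submission where

open import Defs
open import Data.Fin.Base as Fin using (toℕ; fromℕ; fromℕ<)
open import Data.Fin.Properties using (toℕ-fromℕ; toℕ-fromℕ<; ≤fromℕ)
open import Data.Nat.Base using (ℕ; zero; suc; _≤_; _<_; _≥_; z≤n; s≤s⁻¹)
import Data.Nat.Properties as ℕ
open import Data.Product.Base using (_×_; _,_; ∃; proj₁; proj₂)
import Data.Rational.Base as ℚ
import Data.Rational.Properties as ℚ
open import Data.Sum.Base using (_⊎_; inj₁; inj₂; [_,_]′)
open import Function.Base using (_∘_)
open import Function.Bundles using (Func; _⟶ₛ_)
open import Relation.Binary.PropositionalEquality using (refl; sym; subst)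
open import Relation.Nullary.Decidable using (Dec; yes; no)
open import Relation.Nullary.Negation using (¬_; contradiction)
open import Relation.Unary using (_∉_)
open import Relation.Unary.Properties using (⊆′-refl; ⊆′-trans)

-- Comparison of cuts up to double negation

-- For `q` below `y`, openness gives `r` with `q < r` still below `y`. Locatedness of `x` at this
-- pair puts `q` below `x`, or `r` above `x`, and the second case would give `x ≤ᴿ y`.
≰ᴿ⇒≥ᴿ : ∀ x y → ¬ x ≤ᴿ y → y ≤ᴿ x
≰ᴿ⇒≥ᴿ x y x≰y q q∈y with lower-open y q∈y
... | r , q<r , r∈y with located x q<r
...   | inj₁ q∈x = q∈x
...   | inj₂ r∈x = contradiction x≤y x≰y
  where
  x≤y : x ≤ᴿ y
  x≤y p p∈x with p ℚ.<? r
  ... | yes p<r = lower-closed y p<r r∈y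
  ... | no  p≮r = contradiction (p∈x′ , r∈x) (disjoint x)
    where
    p∈x′ : Lower x r
    p∈x′ with lower-open x p∈x
    ... | s , p<s , s∈x = lower-closed x (ℚ.≤-<-trans (ℚ.≮⇒≥ p≮r) p<s) s∈x

≤ᴵ-total : ∀ a b → ¬ ¬ (a ≤ᴵ b ⊎ b ≤ᴵ a)
≤ᴵ-total a b k =
  k (inj₂ (≰ᴿ⇒≥ᴿ (value a) (value b) (k ∘ inj₁)))

-- The witness is rational: a nonnegative `q` below `a` yields `r` with `q < r` still below `a`.
-- Without a witness, every rational below `a` is negative.
between-0-and : ∀ a → ¬ a ≤ᴵ 0ᴵ → ¬ ¬ (∃ λ b → ¬ b ≤ᴵ 0ᴵ × ¬ a ≤ᴵ b)
between-0-and a a≰0 k = a≰0 a≤0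
  where
  a≤0 : a ≤ᴵ 0ᴵ
  a≤0 q q∈a with q ℚ.<? ℚ.0ℚ
  ... | yes q<0 = q<0
  ... | no  q≮0 with lower-open (value a) q∈a
  ...   | r , q<r , r∈a = contradiction
    (b , (λ b≤0 → q≮0 (b≤0 q q<r)) , λ a≤b → ℚ.<-irrefl refl (a≤b r r∈a)) k
    where
    b : [0,1]
    b = mk[0,1] (fromℚ r)
      (λ p p<0 → ℚ.<-trans p<0 (ℚ.≤-<-trans (ℚ.≮⇒≥ q≮0) q<r))
      (λ p p<r → ℚ.<-trans p<r (≤1 a r r∈a))

-- Gluing two tuples at a position

pick : ∀ {P : Set} → Dec P → [0,1] → [0,1] → [0,1]
pick (yes _) a b = a
pick (no  _) a b = b

pick-elim : ∀ {P : Set} (P? : Dec P) {a b} (Q : [0,1] → Set) →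
            (P → Q a) → (¬ P → Q b) → Q (pick P? a b)
pick-elim (yes p) Q f g = f p
pick-elim (no ¬p) Q f g = g ¬p

module _ {n : ℕ} (k : ℕ) (x y : L n)
         (x≤y : ∀ i → toℕ i < k → coord x i ≤ᴵ coord y i) where

  splice : L n
  splice = mkL (λ i → pick (toℕ i ℕ.<? k) (coord x i) (coord y i)) srt
    where
    srt : ∀ {i j} → i Fin.≤ j →
          pick (toℕ i ℕ.<? k) (coord x i) (coord y i) ≤ᴵ
          pick (toℕ j ℕ.<? k) (coord x j) (coord y j)
    srt {i} {j} i≤j with toℕ i ℕ.<? k | toℕ j ℕ.<? k
    ... | yes _   | yes _   = sorted x i≤j
    ... | yes i<k | no  _   = ⊆′-trans (x≤y i i<k) (sorted y i≤j)
    ... | no  i≮k | yes j<k = contradiction (ℕ.≤-<-trans i≤j j<k) i≮k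
    ... | no  _   | no  _   = sorted y i≤j

  splice-elim : ∀ (Q : [0,1] → Set) i → (toℕ i < k → Q (coord x i)) →
                (¬ toℕ i < k → Q (coord y i)) → Q (coord splice i)
  splice-elim Q i = pick-elim (toℕ i ℕ.<? k) Q

module _ {n : ℕ} {N : L-setoid (suc n) ⟶ₛ L-setoid (suc n)}
         (strong : IsStrongFuzzyNegation N) where

  open Func N using (to)
  open IsStrongFuzzyNegation strong
  open IsFuzzyNegation isFuzzyNegation

  last = fromℕ n

  to-≤-swap : ∀ x y → to x ≤ᴸ y → to y ≤ᴸ x
  to-≤-swap x y p i = ⊆′-trans (antitone {to x} {y} p i) (proj₁ (involutive x i))

  ≤-to-swap : ∀ x y → y ≤ᴸ to x → x ≤ᴸ to y
  ≤-to-swap x y p i = ⊆′-trans (proj₂ (involutive x i)) (antitone {y} {to x} p i)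

  to-reflects-≤ : ∀ x y → to x ≤ᴸ to y → y ≤ᴸ x
  to-reflects-≤ x y p i =
    ⊆′-trans (proj₂ (involutive y i)) (to-≤-swap x (to y) p i)

  -- Primality of the images of degenerate elements

  -- The relation x ≤ y ∨ z, phrased by common upper bounds so that no join of cuts is constructed.
  IsJoinBelow : L (suc n) → L (suc n) → L (suc n) → Set₁
  IsJoinBelow x y z = ∀ u → y ≤ᴸ u → z ≤ᴸ u → x ≤ᴸ u

  IsMeetAbove : L (suc n) → L (suc n) → L (suc n) → Set₁
  IsMeetAbove x y z = ∀ u → u ≤ᴸ y → u ≤ᴸ z → u ≤ᴸ x

  -- Under 𝒩 the hypothesis becomes 𝒩(y) ∧ 𝒩(z) ≤ /a/. An element lies below /a/ as soon as its last
  -- coordinate does, so the one of 𝒩(y), 𝒩(z) with the smaller last coordinate lies below /a/.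
  to-/a/-join-prime : ∀ a y z → IsJoinBelow (to / a /) y z →
                      ¬ ¬ (to / a / ≤ᴸ y ⊎ to / a / ≤ᴸ z)
  to-/a/-join-prime a y z x≤y∨z k =
    ≤ᴵ-total (coord (to y) last) (coord (to z) last)
      [ k ∘ inj₁ ∘ ordered y z x≤y∨z
      , k ∘ inj₂ ∘ ordered z y (λ u z≤u y≤u → x≤y∨z u y≤u z≤u) ]′
    where
    ordered : ∀ y z → IsJoinBelow (to / a /) y z →
              coord (to y) last ≤ᴵ coord (to z) last → to / a / ≤ᴸ y
    ordered y z x≤y∨z c≤ = to-≤-swap y / a / (λ i →
      ⊆′-trans (sorted (to y) (≤fromℕ i)) c≤a)
      where
      c = coord (to y) last

      -- The tuple (0,...,0,c) is the least element with last coordinate `c`, hence below both 𝒩(y)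
      -- and 𝒩(z).
      w : L (suc n)
      w = splice (toℕ last) / 0ᴵ / / c / (λ _ _ → 0≤ c)

      w≤ : ∀ v → c ≤ᴵ coord v last → w ≤ᴸ v
      w≤ v c≤v i = splice-elim (toℕ last) / 0ᴵ / / c / (λ _ _ → 0≤ c) (_≤ᴵ coord v i) i
        (λ _ → 0≤ (coord v i))
        (λ i≮n → ⊆′-trans c≤v (sorted v (ℕ.≮⇒≥ i≮n)))

      w≤/a/ : w ≤ᴸ / a /
      w≤/a/ = to-reflects-≤ / a / w
        (x≤y∨z (to w) (≤-to-swap y w (w≤ (to y) ⊆′-refl))
                      (≤-to-swap z w (w≤ (to z) c≤)))

      c≤a : c ≤ᴵ a
      c≤a = ⊆′-trans
        (splice-elim (toℕ last) / 0ᴵ / / c / (λ _ _ → 0≤ c) (c ≤ᴵ_) last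
          (λ n<n → contradiction n<n (ℕ.n≮n (toℕ last)))
          (λ _ → ⊆′-refl))
        (w≤/a/ last)

  -- Dual argument: the first coordinate decides whether an element lies above /a/, and the test
  -- element is (c,1,...,1).
  to-/a/-meet-prime : ∀ a y z → IsMeetAbove (to / a /) y z →
                      ¬ ¬ (y ≤ᴸ to / a / ⊎ z ≤ᴸ to / a /)
  to-/a/-meet-prime a y z y∧z≤x k =
    ≤ᴵ-total (coord (to z) Fin.zero) (coord (to y) Fin.zero)
      [ k ∘ inj₁ ∘ ordered y z y∧z≤x
      , k ∘ inj₂ ∘ ordered z y (λ u u≤z u≤y → y∧z≤x u u≤y u≤z) ]′
    where
    ordered : ∀ y z → IsMeetAbove (to / a /) y z →
              coord (to z) Fin.zero ≤ᴵ coord (to y) Fin.zero → y ≤ᴸ to / a /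
    ordered y z y∧z≤x ≤c = ≤-to-swap y / a / (λ i →
      ⊆′-trans a≤c (sorted (to y) z≤n))
      where
      c = coord (to y) Fin.zero

      w : L (suc n)
      w = splice 1 / c / / 1ᴵ / (λ _ _ → ≤1 c)

      ≤w : ∀ v → coord v Fin.zero ≤ᴵ c → v ≤ᴸ w
      ≤w v v≤c i = splice-elim 1 / c / / 1ᴵ / (λ _ _ → ≤1 c) (coord v i ≤ᴵ_) i
        (λ i<1 → ⊆′-trans (sorted v (s≤s⁻¹ i<1)) v≤c)
        (λ _ → ≤1 (coord v i))

      /a/≤w : / a / ≤ᴸ w
      /a/≤w = to-reflects-≤ w / a /
        (y∧z≤x (to w) (to-≤-swap y w (≤w (to y) ⊆′-refl))
                      (to-≤-swap z w (≤w (to z) ≤c)))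

      a≤c : a ≤ᴵ c
      a≤c = /a/≤w Fin.zero

  -- Shape of the image of a degenerate element

  -- Primality is applied to x = y ∨ z, where y follows x up to position k and stays at x_k
  -- afterwards, while z is 0 up to and including k and follows x afterwards.
  coord-zero-or-last : ∀ a k → let x = to / a / in
    ¬ ¬ (coord x last ≤ᴵ coord x k ⊎ coord x k ≤ᴵ 0ᴵ)
  coord-zero-or-last a k ¬goal = to-/a/-join-prime a y z x≤y∨z
    [ (λ x≤y → ¬goal (inj₁ (⊆′-trans (x≤y last) (y≤xₖ last))))
    , (λ x≤z → ¬goal (inj₂ (⊆′-trans (x≤z k) zₖ≤0))) ]′
    where
    x = to / a /

    below : ∀ i → toℕ i < toℕ k → coord x i ≤ᴵ coord x k
    below i i<k = sorted x (ℕ.<⇒≤ i<k)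

    y z : L (suc n)
    y = splice (toℕ k) x / coord x k / below
    z = splice (suc (toℕ k)) / 0ᴵ / x (λ i _ → 0≤ (coord x i))

    y≤xₖ : ∀ i → coord y i ≤ᴵ coord x k
    y≤xₖ i = splice-elim (toℕ k) x / coord x k / below (_≤ᴵ coord x k) i
      (below i) (λ _ → ⊆′-refl)

    zₖ≤0 : coord z k ≤ᴵ 0ᴵ
    zₖ≤0 = splice-elim (suc (toℕ k)) / 0ᴵ / x (λ i _ → 0≤ (coord x i)) (_≤ᴵ 0ᴵ) k
      (λ _ → ⊆′-refl) (contradiction (ℕ.n<1+n (toℕ k)))

    x≤y∨z : IsJoinBelow x y z
    x≤y∨z u y≤u z≤u i with toℕ i ℕ.≤? toℕ k
    ... | yes i≤k = ⊆′-trans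
      (splice-elim (toℕ k) x / coord x k / below (coord x i ≤ᴵ_) i
        (λ _ → ⊆′-refl) (λ _ → sorted x i≤k))
      (y≤u i)
    ... | no  i≰k = ⊆′-trans
      (splice-elim (suc (toℕ k)) / 0ᴵ / x (λ i _ → 0≤ (coord x i)) (coord x i ≤ᴵ_) i
        (λ i<1+k → contradiction (s≤s⁻¹ i<1+k) i≰k) (λ _ → ⊆′-refl))
      (z≤u i)

  -- Primality is applied to x = y ∧ /x_n/, where x_n is the last coordinate and y is x with that
  -- coordinate raised to 1.
  last-one-or-first : ∀ a → let x = to / a / in
    ¬ ¬ (1ᴵ ≤ᴵ coord x last ⊎ coord x last ≤ᴵ coord x Fin.zero)
  last-one-or-first a ¬goal = to-/a/-meet-prime a y / coord x last / y∧z≤x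
    [ (λ y≤x → ¬goal (inj₁ (⊆′-trans 1≤yₙ (y≤x last))))
    , (λ z≤x → ¬goal (inj₂ (z≤x Fin.zero))) ]′
    where
    x = to / a /

    y : L (suc n)
    y = splice (toℕ last) x / 1ᴵ / (λ i _ → ≤1 (coord x i))

    1≤yₙ : 1ᴵ ≤ᴵ coord y last
    1≤yₙ = splice-elim (toℕ last) x / 1ᴵ / (λ i _ → ≤1 (coord x i)) (1ᴵ ≤ᴵ_) last
      (λ n<n → contradiction n<n (ℕ.n≮n (toℕ last))) (λ _ → ⊆′-refl)

    y∧z≤x : IsMeetAbove x y / coord x last /
    y∧z≤x u u≤y u≤z i with toℕ i ℕ.<? toℕ last
    ... | yes i<n = ⊆′-trans (u≤y i)
      (splice-elim (toℕ last) x / 1ᴵ / (λ i _ → ≤1 (coord x i)) (_≤ᴵ coord x i) i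
        (λ _ → ⊆′-refl) (contradiction i<n))
    ... | no  i≮n = ⊆′-trans (u≤z i) (sorted x (ℕ.≮⇒≥ i≮n))

  -- Descent on the number of zeros

  -- Induction on `m`, which bounds the number of coordinates different from 1. For 0 < b < a,
  -- coordinate `m` of 𝒩(/b/) is 1 or 0: the value 1 lets the induction continue with `b`, the value
  -- 0 forces a ≤ b.
  ones-from⇒zero : ∀ m → m ≤ n → ∀ a →
    (∀ i → m ≤ toℕ i → 1ᴵ ≤ᴵ coord (to / a /) i) → ¬ ¬ a ≤ᴵ 0ᴵ
  -- All coordinates are 1 here, so /1/ ≤ 𝒩(/a/) and therefore /a/ ≤ 𝒩(/1/) = /0/.
  ones-from⇒zero zero _ a ones a≰0 =
    a≰0 (⊆′-trans (≤-to-swap / a / / 1ᴵ / (λ i → ones i z≤n) last) (proj₁ (to-1 last)))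
  ones-from⇒zero (suc m) m<n a ones a≰0 =
    between-0-and a a≰0 λ (b , b≰0 , a≰b) →
      let
        x = to / a /
        y = to / b /
        b≤a = ≰ᴿ⇒≥ᴿ (value a) (value b) a≰b
        x≤y = antitone {/ b /} {/ a /} (λ _ → b≤a)
        1≤yₙ = ⊆′-trans (ones last (subst (suc m ≤_) (sym (toℕ-fromℕ n)) m<n)) (x≤y last)

        ones′ : coord y last ≤ᴵ coord y k → ∀ i → m ≤ toℕ i → 1ᴵ ≤ᴵ coord y i
        ones′ yₙ≤yₖ i m≤i = ⊆′-trans 1≤yₙ (⊆′-trans yₙ≤yₖ
          (sorted y (subst (_≤ toℕ i) (sym k≡m) m≤i)))

        -- By sortedness `y` vanishes up to position `m`, and `x` is 1 beyond it.
        y≤x : coord y k ≤ᴵ 0ᴵ → y ≤ᴸ x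
        y≤x yₖ≤0 i = [ (λ i≤m → ⊆′-trans (sorted y (subst (toℕ i ≤_) (sym k≡m) i≤m))
                                  (⊆′-trans yₖ≤0 (0≤ (coord x i))))
                     , (λ m<i → ⊆′-trans (≤1 (coord y i)) (ones i m<i)) ]′
                     (ℕ.≤-<-connex (toℕ i) m)
      in coord-zero-or-last b k
        [ (λ yₙ≤yₖ → ones-from⇒zero m (ℕ.<⇒≤ m<n) b (ones′ yₙ≤yₖ) b≰0)
        , (λ yₖ≤0 → a≰b (to-reflects-≤ / b / / a / (y≤x yₖ≤0) last)) ]′
    where
    m<1+n = ℕ.m≤n⇒m≤1+n m<n
    k = fromℕ< m<1+n
    k≡m = toℕ-fromℕ< m<1+n

  last-one⇒zero : ∀ a → 1ᴵ ≤ᴵ coord (to / a /) last → ¬ ¬ a ≤ᴵ 0ᴵ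
  last-one⇒zero a 1≤xₙ = ones-from⇒zero n ℕ.≤-refl a λ i n≤i →
    ⊆′-trans 1≤xₙ (sorted (to / a /) (subst (_≤ toℕ i) (sym (toℕ-fromℕ n)) n≤i))

  to-/a/-degenerate : ∀ a → ¬ ¬ coord (to / a /) last ≤ᴵ coord (to / a /) Fin.zero
  to-/a/-degenerate a ¬goal = last-one-or-first a
    -- A last coordinate 1 gives a = 0, so the first coordinate is at least that of 𝒩(/0/), which is
    -- 1.
    [ (λ 1≤xₙ → last-one⇒zero a 1≤xₙ λ a≤0 → ¬goal
        (⊆′-trans (≤1 (coord (to / a /) last))
          (⊆′-trans (proj₂ (to-0 Fin.zero))
            (antitone {/ a /} {/ 0ᴵ /} (λ _ → a≤0) Fin.zero))))
    , ¬goal ]′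

theorem21 : ∀ (n : ℕ) → n ≥ 1 →
    (N : L-setoid n ⟶ₛ L-setoid n) → IsStrongFuzzyNegation N →
    ∀ (x : L n) → x ∉ 𝓓 n → Func.to N x ∉ 𝓓 n
theorem21 (suc n) _ N strong x x∉𝓓 (a , Nx≈/a/) =
  -- By involutivity `x` equals 𝒩(/a/), whose coordinates all lie between the first and the last
  -- one.
  to-/a/-degenerate strong a λ yₙ≤y₀ → x∉𝓓
    ( coord y Fin.zero
    , λ i → ⊆′-trans (x≤y i) (⊆′-trans (sorted y (≤fromℕ i)) yₙ≤y₀)
          , ⊆′-trans (sorted y z≤n) (y≤x i) )
  where
  open Func N using (to; cong)
  open IsStrongFuzzyNegation strong
  y = to / a /

  NNx≈y : to (to x) ≈ᴸ y
  NNx≈y = cong Nx≈/a/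

  x≤y : x ≤ᴸ y
  x≤y i = ⊆′-trans (proj₂ (involutive x i)) (proj₁ (NNx≈y i))

  y≤x : y ≤ᴸ x
  y≤x i = ⊆′-trans (proj₂ (NNx≈y i)) (proj₁ (involutive x i))
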